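{- Let $\mathcal{P}$ be a finite collection of parameterizations of vector cycles of length 5 in $\mathbb{Z}^3$. Then there exists some $t \in T$ that is not represented by any parameterization in $\mathcal{P}$.
   Context: $T$ is the set of positive integers $t \equiv 2 \pmod 4$ whose square-free part has at least one odd prime factor $p$ with $p \equiv 2 \pmod 3$. A parameterization of a vector cycle of length 5 in $\mathbb{Z}^3$ is a list of five vectors $w_1, \ldots, w_5$ whose coordinates are integer linear forms $\lambda x + \mu y$ ($\lambda, \mu \in \mathbb{Z}$) in two variables $x, y$, such that $w_1 + \cdots + w_5 = \mathbf{0}$ identically and the squared Euclidean norms $|w_1|^2, \ldots, |w_5|^2$ are all equal to one and the same binary quadratic form $F(x,y) = ax^2 + bxy + cy^2$. Such a parameterization represents a positive integer $t$ if there exist integers $x, y$ with $F(x,y) = t$ (i.e., substituting these $x,y$ yields five vectors of $\mathbb{Z}^3$, each of magnitude $\sqrt{t}$, summing to zero). -}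

module Defs where

open import Algebra.Properties.Monoid.Sum using (sum)
open import Data.Fin.Base using (Fin)
open import Data.Integer.Base using (ℤ; +_; 0ℤ; _+_; _*_)
open import Data.Integer.Properties using (+-0-monoid)
open import Data.Nat.Base as ℕ using (ℕ)
open import Data.Nat.DivMod using (_%_)
open import Data.Nat.Divisibility using (_∣_)
open import Data.Nat.Primality using (Prime)
open import Data.Product.Base using (_×_; ∃-syntax)
open import Data.Vec.Functional using (Vector)
open import Relation.Binary.PropositionalEquality.Core using (_≡_)

SquareFree : ℕ → Set
SquareFree s = ∀ d → d ℕ.* d ∣ s → d ≡ 1

-- For t > 0 there is exactly one such s.
_IsSquareFreePartOf_ : ℕ → ℕ → Set
s IsSquareFreePartOf t = SquareFree s × ∃[ m ] t ≡ s ℕ.* (m ℕ.* m)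

record T (t : ℕ) : Set where
  field
    positive    : 0 ℕ.< t
    2-mod-4     : t % 4 ≡ 2
    s           : ℕ
    s-sqfPart   : s IsSquareFreePartOf t
    p           : ℕ
    p-prime     : Prime p
    p-odd       : p % 2 ≡ 1
    p-divides-s : p ∣ s
    p-2-mod-3   : p % 3 ≡ 2

∑ : ∀ {n} → Vector ℤ n → ℤ
∑ = sum +-0-monoid

-- The form λ x + μ y.
record LinearForm : Set where
  constructor linearForm
  field
    λₓ μᵧ : ℤ

evalLin : LinearForm → ℤ → ℤ → ℤ
evalLin (linearForm l m) x y = l * x + m * y

-- The form a x² + b x y + c y².
record QuadraticForm : Set where
  constructor quadraticForm
  field
    a b c : ℤ

evalQuad : QuadraticForm → ℤ → ℤ → ℤ
evalQuad (quadraticForm a b c) x y = a * (x * x) + b * (x * y) + c * (y * y)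

normSq : ∀ {n} → Vector ℤ n → ℤ
normSq v = ∑ λ j → v j * v j

-- Identities between forms are stated as identities of functions on ℤ²,
-- which over ℤ is the same as equality of coefficients.
record Parameterization : Set where
  field
    w : Vector (Vector LinearForm 3) 5
    F : QuadraticForm

  at : ℤ → ℤ → Vector (Vector ℤ 3) 5
  at x y i j = evalLin (w i j) x y

  field
    sum-zero   : ∀ x y (j : Fin 3) → ∑ (λ i → at x y i j) ≡ 0ℤ
    equal-norm : ∀ x y (i : Fin 5) → normSq (at x y i) ≡ evalQuad F x y

_Represents_ : Parameterization → ℕ → Set
P Represents t = ∃[ x ] ∃[ y ] evalQuad (Parameterization.F P) x y ≡ + t

{-# OPTIONS --safe #-}

-- Each F takes only non-negative values, so d = 4ac - b² ≥ 0.  For every such F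
-- there is a prime p ≡ 3 (mod 4) such that p ∣ F(x,y) implies p² ∣ F(x,y):
-- if d > 0, take p ∣ 4d - 1, so that -d ≡ -1/4 is a non-residue modulo p and F is
-- anisotropic modulo p; if d = 0, then F is a rational multiple of the square of a
-- linear form, and any p not dividing a (or c, when a = 0) will do.  Hence a
-- squarefree t divisible by all these primes is not represented; take for t the
-- product of 2, 5 and the distinct primes so obtained.

module Submission where

open import Defs
open import Data.Empty using (⊥)
open import Data.Fin.Base using (zero; suc)
open import Data.Integer.Base as ℤ using (ℤ; +_; -[1+_]; 0ℤ; 1ℤ; -1ℤ; ∣_∣; +≤+)
open import Data.Integer.Divisibility.Signed as ℤ∣ using (divides)
import Data.Integer.Properties as ℤ
import Data.Integer.Tactic.RingSolver as ℤ-Ring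
open import Data.List.Base using (List; []; _∷_)
open import Data.List.Relation.Unary.All as All using (All; []; _∷_)
open import Data.Nat.Base
open import Data.Nat.Coprimality using (Coprime; coprime-Bézout; coprime-divisor)
open import Data.Nat.Divisibility
open import Data.Nat.DivMod
open import Data.Nat.GCD using (module Bézout)
open import Data.Nat.Induction using (<-rec)
open import Data.Nat.ListAction using (product)
open import Data.Nat.Primality using (Prime; prime?; prime[2]; ¬prime[1]; prime⇒nonZero; prime⇒irreducible; euclidsLemma)
open import Data.Nat.Primality.Factorisation using (factorise)
open import Data.Nat.Properties
import Data.Nat.Tactic.RingSolver as ℕ-Ring
open import Data.Product.Base using (_×_; _,_; ∃-syntax)
open import Data.Sum.Base using (_⊎_; inj₁; inj₂; [_,_]′)
open import Function.Base using (_∘_; id)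
open import Relation.Binary.PropositionalEquality
open import Relation.Nullary.Decidable using (yes; no; toWitness)
open import Relation.Nullary.Negation using (¬_; contradiction)

-- Sums of two squares modulo a prime p ≡ 3 (mod 4)

k*3%4≡1⇒k≡3 : ∀ {k} → k < 4 → k * 3 % 4 ≡ 1 → k ≡ 3
k*3%4≡1⇒k≡3 {3} _ _ = refl
k*3%4≡1⇒k≡3 {suc (suc (suc (suc _)))} (s≤s (s≤s (s≤s (s≤s ())))) _

-- Modulo 4 the residue 3 is its own inverse. In the descent below, `m` is the cofactor of `n` in a
-- number ≡ 1 (mod 4).
m*n≡1∧n≡3⇒m≡3[mod4] : ∀ m n → m * n % 4 ≡ 1 → n % 4 ≡ 3 → m % 4 ≡ 3
m*n≡1∧n≡3⇒m≡3[mod4] m n mn≡1 n≡3 = k*3%4≡1⇒k≡3 (m%n<n m 4)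
  (trans (cong (λ k → m % 4 * k % 4) (sym n≡3)) (trans (sym (%-distribˡ-* m n 4)) mn≡1))

%4≡3⇒%2≡1 : ∀ n → n % 4 ≡ 3 → n % 2 ≡ 1
%4≡3⇒%2≡1 n n≡3 = trans (sym (m∣n⇒o%n%m≡o%m 2 4 n (divides 2 refl))) (cong (_% 2) n≡3)

%2-cases : ∀ n → n % 2 ≡ 0 ⊎ n % 2 ≡ 1
%2-cases n = go (m%n<n n 2)
  where
  go : ∀ {k} → k < 2 → k ≡ 0 ⊎ k ≡ 1
  go {0} _ = inj₁ refl
  go {1} _ = inj₂ refl
  go {suc (suc _)} (s≤s (s≤s ()))

odd+odd : ∀ m n → m % 2 ≡ 1 → n % 2 ≡ 1 → (m + n) % 2 ≡ 0
odd+odd m n m≡1 n≡1 = trans (%-distribˡ-+ m n 2) (cong₂ (λ i j → (i + j) % 2) m≡1 n≡1)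

-- Descent: if n ∣ r² + 1 with r < n even, then the cofactor is again ≡ 3 (mod 4)
-- and smaller than n.
%4≡3⇒∤z²+1 : ∀ n → n % 4 ≡ 3 → ∀ z → ¬ n ∣ z * z + 1
%4≡3⇒∤z²+1 = <-rec (λ n → n % 4 ≡ 3 → ∀ z → ¬ n ∣ z * z + 1) step
  where
  step : ∀ n → (∀ {m} → m < n → m % 4 ≡ 3 → ∀ z → ¬ m ∣ z * z + 1) →
         n % 4 ≡ 3 → ∀ z → ¬ n ∣ z * z + 1
  step n@(suc (suc k)) ih n≡3 z n∣z²+1 = reduced (%2-cases r)
    where
    r = z % n
    q = z / n

    even : ∀ r → r < n → r % 2 ≡ 0 → ¬ n ∣ r * r + 1
    even r r<n r≡0 (divides m eq) = ih m<n m≡3 r (divides n (trans eq (*-comm m n)))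
      where
      h = r / 2
      r²+1≡1+h²4 : r * r + 1 ≡ 1 + h * h * 4
      r²+1≡1+h²4 = trans (cong (λ s → s * s + 1) (trans (m≡m%n+[m/n]*n r 2) (cong (_+ h * 2) r≡0)))
                         (ident h)
        where
        ident : ∀ h → h * 2 * (h * 2) + 1 ≡ 1 + h * h * 4
        ident = ℕ-Ring.solve-∀
      m≡3 : m % 4 ≡ 3
      m≡3 = m*n≡1∧n≡3⇒m≡3[mod4] m n
        (trans (cong (_% 4) (trans (sym eq) r²+1≡1+h²4)) ([m+kn]%n≡m%n 1 (h * h) 4)) n≡3
      -- Since n = k + 2 and r ≤ k + 1, mn = r² + 1 is at most (n - 1)² + 1, which falls short of n²
      -- by 2k + 2.
      m<n : m < n
      m<n = *-cancelʳ-< n m n (begin-strict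
        m * n                                       ≡⟨ eq ⟨
        r * r + 1                                   ≤⟨ +-monoˡ-≤ 1 (*-mono-≤ (s≤s⁻¹ r<n) (s≤s⁻¹ r<n)) ⟩
        suc k * suc k + 1                           <⟨ m<m+n _ z<s ⟩
        suc k * suc k + 1 + suc (suc (k + k))       ≡⟨ ident k ⟩
        n * n                                       ∎)
        where
        open ≤-Reasoning
        ident : ∀ k → suc k * suc k + 1 + suc (suc (k + k)) ≡ suc (suc k) * suc (suc k)
        ident = ℕ-Ring.solve-∀

    n∣r²+1 : n ∣ r * r + 1
    n∣r²+1 = ∣m+n∣m⇒∣n
      (subst (n ∣_) (trans (cong (λ s → s * s + 1) (m≡m%n+[m/n]*n z n)) (ident r q n)) n∣z²+1)
      (n∣m*n (2 * r * q + q * q * n))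
      where
      ident : ∀ r q n → (r + q * n) * (r + q * n) + 1 ≡ (2 * r * q + q * q * n) * n + (r * r + 1)
      ident = ℕ-Ring.solve-∀

    reduced : r % 2 ≡ 0 ⊎ r % 2 ≡ 1 → ⊥
    reduced (inj₁ r≡0) = even r (m%n<n z n) r≡0 n∣r²+1
    reduced (inj₂ r≡1) = even r′ r′<n r′≡0 n∣r′²+1
      where
      -- For odd r, pass to n - r ≡ -r: it has the same square modulo n, and it is even because n is
      -- odd.
      r′ = n ∸ r
      n≡r+r′ : n ≡ r + r′
      n≡r+r′ = sym (m+[n∸m]≡n (<⇒≤ (m%n<n z n)))
      r>0 : r > 0
      r>0 = n≢0⇒n>0 (λ r≡0 → contradiction (trans (sym (cong (_% 2) r≡0)) r≡1) λ ())
      r′<n : r′ < n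
      r′<n = subst (r′ <_) (sym n≡r+r′) (m<n+m r′ r>0)
      r′≡0 : r′ % 2 ≡ 0
      r′≡0 = [ id , (λ r′≡1 → contradiction
        (trans (sym (odd+odd r r′ r≡1 r′≡1)) (trans (cong (_% 2) (sym n≡r+r′)) (%4≡3⇒%2≡1 n n≡3))) λ ()) ]′
        (%2-cases r′)
      n∣r′²+1 : n ∣ r′ * r′ + 1
      -- With n = r + r′, r² + 1 + nr′ = nr + (r′² + 1); this form avoids subtraction in ℕ.
      n∣r′²+1 = ∣m+n∣m⇒∣n
        (subst (n ∣_) (trans (cong (λ s → r * r + 1 + s * r′) n≡r+r′)
                      (trans (ident r r′) (cong (λ s → s * r + (r′ * r′ + 1)) (sym n≡r+r′))))
          (∣m∣n⇒∣m+n n∣r²+1 (m∣m*n r′)))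
        (m∣m*n r)
        where
        ident : ∀ r r′ → r * r + 1 + (r + r′) * r′ ≡ (r + r′) * r + (r′ * r′ + 1)
        ident = ℕ-Ring.solve-∀

prime∤⇒coprime : ∀ {p n} → Prime p → p ∤ n → Coprime p n
prime∤⇒coprime pr p∤n (d∣p , d∣n) with prime⇒irreducible pr d∣p
... | inj₁ d≡1  = d≡1
... | inj₂ refl = contradiction d∣n p∤n

-- If p ∤ y, then multiplying x² + y² by the square of the inverse u of y gives
-- p ∣ (ux)² + 1.
∣x²+y²⇒∣y : ∀ {p} → Prime p → p % 4 ≡ 3 → ∀ x y → p ∣ x * x + y * y → p ∣ y
∣x²+y²⇒∣y {p} pr p≡3 x y p∣ with p ∣? y
... | yes p∣y = p∣y
... | no p∤y with coprime-Bézout (prime∤⇒coprime pr p∤y)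
-- Bézout over ℕ has two sign cases. Here uy ≡ 1 (mod p), so (uy)² contributes the summand 1
-- directly.
...   | Bézout.-+ v u 1+vp≡uy = contradiction
  (∣m+n∣m⇒∣n (subst (p ∣_) eq (∣n⇒∣m*n (u * u) p∣)) (n∣m*n (2 * v + v * v * p)))
  (%4≡3⇒∤z²+1 p p≡3 (u * x))
  where
  split : ∀ u x y → u * u * (x * x + y * y) ≡ u * x * (u * x) + u * y * (u * y)
  split = ℕ-Ring.solve-∀
  expand : ∀ z v p → z * z + (1 + v * p) * (1 + v * p) ≡ (2 * v + v * v * p) * p + (z * z + 1)
  expand = ℕ-Ring.solve-∀
  eq : u * u * (x * x + y * y) ≡ (2 * v + v * v * p) * p + (u * x * (u * x) + 1)
  eq = trans (split u x y)
    (trans (cong (λ s → u * x * (u * x) + s * s) (sym 1+vp≡uy)) (expand (u * x) v p))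
-- Here uy ≡ -1 (mod p). Adding the multiple 1 + uy of p turns (uy)² into (1 + uy)uy + 1, again
-- leaving the summand 1.
...   | Bézout.+- v u 1+uy≡vp = contradiction
  (∣m+n∣m⇒∣n
    (subst (p ∣_) (split u x y) (∣m∣n⇒∣m+n (∣n⇒∣m*n (u * u) p∣) p∣1+uy))
    (∣m⇒∣m*n (u * y) p∣1+uy))
  (%4≡3⇒∤z²+1 p p≡3 (u * x))
  where
  p∣1+uy : p ∣ 1 + u * y
  p∣1+uy = divides v 1+uy≡vp
  split : ∀ u x y → u * u * (x * x + y * y) + (1 + u * y) ≡ (1 + u * y) * (u * y) + (u * x * (u * x) + 1)
  split = ℕ-Ring.solve-∀

-- Prime factors ≡ 3 (mod 4)

record Prime3mod4 (p : ℕ) : Set where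
  constructor _,_
  field
    prime : Prime p
    %4≡3  : p % 4 ≡ 3

-- Modulo 4, the residue 3 arises as a product only from 1 · 3 or 3 · 1, so it can be traced through
-- the prime factorisation to a single factor.
primeFactor3mod4 : ∀ n → n % 4 ≡ 3 → ∃[ p ] Prime3mod4 p × p ∣ n
primeFactor3mod4 n@(suc _) n≡3 with record { factors = ps ; isFactorisation = eq ; factorsPrime = primes } ← factorise n =
  let p , p3 , p∣ = go ps primes (trans (cong (_% 4) (sym eq)) n≡3) in p , p3 , subst (p ∣_) (sym eq) p∣
  where
  factor≡3 : ∀ i → i < 4 → ∀ j → j < 4 → i * j % 4 ≡ 3 → i ≡ 3 ⊎ j ≡ 3
  factor≡3 0 _ j _ ()
  factor≡3 1 _ 3 _ _ = inj₂ refl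
  factor≡3 2 _ 0 _ ()
  factor≡3 2 _ 1 _ ()
  factor≡3 2 _ 2 _ ()
  factor≡3 2 _ 3 _ ()
  factor≡3 3 _ _ _ _ = inj₁ refl
  factor≡3 _ _ (suc (suc (suc (suc _)))) (s≤s (s≤s (s≤s (s≤s ())))) _
  factor≡3 (suc (suc (suc (suc _)))) (s≤s (s≤s (s≤s (s≤s ())))) _ _ _

  go : ∀ ps → All Prime ps → product ps % 4 ≡ 3 → ∃[ p ] Prime3mod4 p × p ∣ product ps
  go (p ∷ ps) (pr ∷ prs) eq
    with factor≡3 (p % 4) (m%n<n p 4) (product ps % 4) (m%n<n (product ps) 4)
           (trans (sym (%-distribˡ-* p (product ps) 4)) eq)
  ... | inj₁ p≡3 = p , (pr , p≡3) , m∣m*n (product ps)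
  ... | inj₂ ps≡3 = let q , q3 , q∣ = go ps prs ps≡3 in q , q3 , ∣n⇒∣m*n p q∣

-- Obstructing primes and divisibility

-- The field `∣⇒²∣` excludes p-adic valuation exactly 1 for represented values. The field
-- `prime3mod4` also guarantees that p is odd, which keeps the product of these primes odd.
record _Obstructs_ (p : ℕ) (F : QuadraticForm) : Set where
  field
    prime3mod4 : Prime3mod4 p
    ∣⇒²∣       : ∀ x y {t} → evalQuad F x y ≡ + t → p ∣ t → p * p ∣ t

i*i≡+∣i∣*∣i∣ : ∀ i → i ℤ.* i ≡ + (∣ i ∣ * ∣ i ∣)
i*i≡+∣i∣*∣i∣ (+ n)    = sym (ℤ.pos-* n n)
i*i≡+∣i∣*∣i∣ -[1+ n ] = refl

0≤i*i : ∀ i → 0ℤ ℤ.≤ i ℤ.* i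
0≤i*i i = subst (0ℤ ℤ.≤_) (sym (i*i≡+∣i∣*∣i∣ i)) (+≤+ z≤n)

*-pres-∣ℤ : ∀ {i j k l} → i ℤ∣.∣ j → k ℤ∣.∣ l → i ℤ.* k ℤ∣.∣ j ℤ.* l
*-pres-∣ℤ {i} {k = k} (divides q refl) (divides r refl) = divides (q ℤ.* r) (ident q i r k)
  where
  ident : ∀ q i r k → q ℤ.* i ℤ.* (r ℤ.* k) ≡ q ℤ.* r ℤ.* (i ℤ.* k)
  ident = ℤ-Ring.solve-∀

∤-* : ∀ {p m n} → Prime p → p ∤ m → p ∤ n → p ∤ m * n
∤-* {m = m} {n} pr p∤m p∤n = [ p∤m , p∤n ]′ ∘ euclidsLemma m n pr

p²∣k*n⇒p²∣n : ∀ {p k n} → Prime p → p ∤ k → p * p ∣ k * n → p * p ∣ n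
p²∣k*n⇒p²∣n {p} {k} {n} pr p∤k p²∣kn = coprime-divisor p²⊥k p²∣kn
  where
  p²⊥k : Coprime (p * p) k
  p²⊥k {d} (d∣p² , d∣k) = prime∤⇒coprime pr p∤k (coprime-divisor d⊥p d∣p² , d∣k)
    where
    d⊥p : Coprime d p
    d⊥p (e∣d , e∣p) = prime∤⇒coprime pr p∤k (e∣p , ∣-trans e∣d d∣k)

%4≡3⇒∤2 : ∀ {p} → p % 4 ≡ 3 → p ∤ 2
%4≡3⇒∤2 {suc (suc (suc _))} _ p∣2 with s≤s (s≤s ()) ← ∣⇒≤ p∣2

module _ {p : ℕ} (p3 : Prime3mod4 p) where
  open Prime3mod4 p3

  ∤4 : p ∤ 4
  ∤4 = ∤-* {m = 2} prime (%4≡3⇒∤2 %4≡3) (%4≡3⇒∤2 %4≡3)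

  ∣i²+j²⇒∣j : ∀ i j → + p ℤ∣.∣ i ℤ.* i ℤ.+ j ℤ.* j → + p ℤ∣.∣ j
  ∣i²+j²⇒∣j i j p∣ = ℤ∣.∣ᵤ⇒∣ (∣x²+y²⇒∣y prime %4≡3 ∣ i ∣ ∣ j ∣
    (ℤ∣.∣⇒∣ᵤ (subst (+ p ℤ∣.∣_) (cong₂ ℤ._+_ (i*i≡+∣i∣*∣i∣ i) (i*i≡+∣i∣*∣i∣ j)) p∣)))

  ∣i²+j²⇒∣i : ∀ i j → + p ℤ∣.∣ i ℤ.* i ℤ.+ j ℤ.* j → + p ℤ∣.∣ i
  ∣i²+j²⇒∣i i j = ∣i²+j²⇒∣j j i ∘ subst (+ p ℤ∣.∣_) (ℤ.+-comm (i ℤ.* i) (j ℤ.* j))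

  p²∣kt⇒p²∣t : ∀ {k t} → p ∤ k → + p ℤ.* + p ℤ∣.∣ + k ℤ.* + t → p * p ∣ t
  p²∣kt⇒p²∣t {k} {t} p∤k p²∣ = p²∣k*n⇒p²∣n prime p∤k
    (subst₂ _∣_ (ℤ.abs-* (+ p) (+ p)) (ℤ.abs-* (+ k) (+ t)) (ℤ∣.∣⇒∣ᵤ p²∣))

  -- The degenerate case: p ∣ i² forces p ∣ i, so p² divides i² = kt, and k cancels because p does
  -- not divide it.
  kt≡i²⇒p²∣t : ∀ {k t} i → p ∤ k → + k ℤ.* + t ≡ i ℤ.* i → p ∣ t → p * p ∣ t
  kt≡i²⇒p²∣t {k} {t} i p∤k eq p∣t = p²∣kt⇒p²∣t p∤k (subst (_ ℤ∣.∣_) (sym eq) (*-pres-∣ℤ p∣i p∣i))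
    where
    p∣i² : p ∣ ∣ i ∣ * ∣ i ∣
    p∣i² = subst (p ∣_) (ℤ.abs-* i i)
      (ℤ∣.∣⇒∣ᵤ (subst (+ p ℤ∣.∣_) eq (ℤ∣.∣n⇒∣m*n (+ k) (ℤ∣.∣ᵤ⇒∣ p∣t))))
    p∣i : + p ℤ∣.∣ i
    p∣i = ℤ∣.∣ᵤ⇒∣ ([ id , id ]′ (euclidsLemma ∣ i ∣ ∣ i ∣ prime p∣i²))

-- The number is 4(k + 1) - 1. Applied to a leading coefficient k + 1 it yields a prime not dividing
-- it; applied to d it yields a prime with 4d ≡ 1.
primeFactor-4k-1 : ∀ k → ∃[ p ] Prime3mod4 p × p ∣ 3 + k * 4
primeFactor-4k-1 k = primeFactor3mod4 (3 + k * 4) ([m+kn]%n≡m%n 3 k 4)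

∣4k-1⇒∤k : ∀ {p} → Prime p → ∀ k → p ∣ 3 + k * 4 → p ∤ suc k
∣4k-1⇒∤k {p} pr k p∣ p∣k = ¬prime[1] (subst Prime (∣1⇒≡1 p∣1) pr)
  where
  p∣1 : p ∣ 1
  p∣1 = ∣m+n∣m⇒∣n (subst (p ∣_) (+-comm 1 (3 + k * 4)) (∣m⇒∣m*n 4 p∣k)) p∣

-- Obstructing primes for positive semidefinite forms

negDisc : QuadraticForm → ℤ
negDisc (quadraticForm a b c) = + 4 ℤ.* a ℤ.* c ℤ.- b ℤ.* b

obstruction-a≡0∧b≡0 : ∀ n → ∃[ p ] p Obstructs quadraticForm 0ℤ 0ℤ (+ n)
-- The zero form takes only the value 0, which 9 divides; 3 is the smallest prime ≡ 3 (mod 4).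
obstruction-a≡0∧b≡0 zero = 3 , record
  { prime3mod4 = toWitness {a? = prime? 3} _ , refl
  ; ∣⇒²∣       = λ { _ _ refl _ → 9 ∣0 } }
obstruction-a≡0∧b≡0 (suc k) with p , p3 , p∣ ← primeFactor-4k-1 k = p , record
  { prime3mod4 = p3
  ; ∣⇒²∣       = λ x y eq → kt≡i²⇒p²∣t p3 (c ℤ.* y)
      (∣4k-1⇒∤k (Prime3mod4.prime p3) k p∣)
      (trans (cong (c ℤ.*_) (sym eq)) (ident c x y)) }
  where
  c = + suc k
  ident : ∀ c x y → c ℤ.* (0ℤ ℤ.* (x ℤ.* x) ℤ.+ 0ℤ ℤ.* (x ℤ.* y) ℤ.+ c ℤ.* (y ℤ.* y)) ≡ c ℤ.* y ℤ.* (c ℤ.* y)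
  ident = ℤ-Ring.solve-∀

-- Completing the square gives 4aF = (2ax + by)² + dy², and the last term vanishes.
obstruction-parabolic : ∀ k b c → negDisc (quadraticForm (+ suc k) b c) ≡ 0ℤ →
                     ∃[ p ] p Obstructs quadraticForm (+ suc k) b c
obstruction-parabolic k b c d≡0 with p , p3 , p∣ ← primeFactor-4k-1 k = p , record
  { prime3mod4 = p3
  ; ∣⇒²∣       = λ x y eq → kt≡i²⇒p²∣t p3 (+ 2 ℤ.* a ℤ.* x ℤ.+ b ℤ.* y)
      (∤-* {m = 4} (Prime3mod4.prime p3) (∤4 p3) (∣4k-1⇒∤k (Prime3mod4.prime p3) k p∣))
      (trans (cong₂ ℤ._*_ (ℤ.pos-* 4 (suc k)) (sym eq))
        (trans (ident a b c x y)
          (trans (cong (λ d → (+ 2 ℤ.* a ℤ.* x ℤ.+ b ℤ.* y) ℤ.* (+ 2 ℤ.* a ℤ.* x ℤ.+ b ℤ.* y) ℤ.+ d ℤ.* (y ℤ.* y)) d≡0)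
            (ℤ.+-identityʳ _)))) }
  where
  a = + suc k
  ident : ∀ a b c x y →
    + 4 ℤ.* a ℤ.* (a ℤ.* (x ℤ.* x) ℤ.+ b ℤ.* (x ℤ.* y) ℤ.+ c ℤ.* (y ℤ.* y)) ≡
    (+ 2 ℤ.* a ℤ.* x ℤ.+ b ℤ.* y) ℤ.* (+ 2 ℤ.* a ℤ.* x ℤ.+ b ℤ.* y) ℤ.+
    (+ 4 ℤ.* a ℤ.* c ℤ.- b ℤ.* b) ℤ.* (y ℤ.* y)
  ident = ℤ-Ring.solve-∀

-- Write D for the value `suc d` of `negDisc`. Then 16aF = (4D - 1)y² + (X² + y²) with X = 4ax +
-- 2by. If p divides 4D - 1 and F(x,y), it divides X² + y², hence both X and y, so p² divides 16aF;
-- finally 16a cancels.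
obstruction-definite : ∀ k b c d → negDisc (quadraticForm (+ suc k) b c) ≡ + suc d →
                    ∃[ p ] p Obstructs quadraticForm (+ suc k) b c
obstruction-definite k b c d d≡ with p , p3 , p∣4d-1 ← primeFactor-4k-1 d = p , record
  { prime3mod4 = p3
  ; ∣⇒²∣       = ∣⇒²∣ p3 p∣4d-1 }
  where
  a = + suc k
  e = + (3 + d * 4)

  e≡4d-1 : e ≡ + 4 ℤ.* negDisc (quadraticForm a b c) ℤ.- 1ℤ
  e≡4d-1 = trans (cong (λ n → + (3 + n)) (*-comm d 4))
    (trans (cong (λ n → + n ℤ.- 1ℤ) (sym (*-suc 4 d)))
      (cong (ℤ._- 1ℤ) (trans (ℤ.pos-* 4 (suc d)) (cong (+ 4 ℤ.*_) (sym d≡)))))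

  module _ {p} (p3 : Prime3mod4 p) (p∣4d-1 : p ∣ 3 + d * 4) where
    open Prime3mod4 p3

    p∣e : + p ℤ∣.∣ e
    p∣e = ℤ∣.∣ᵤ⇒∣ p∣4d-1

    -- Modulo a prime p ∣ a, the relation 4d ≡ 1 reads (2b)² ≡ -1.
    p∤a : p ∤ suc k
    p∤a p∣a = ¬prime[1] (subst Prime (∣1⇒≡1 (ℤ∣.∣⇒∣ᵤ (∣i²+j²⇒∣j p3 (+ 2 ℤ.* b) 1ℤ p∣4b²+1))) prime)
      where
      ident : ∀ a b c → + 16 ℤ.* c ℤ.* a ℤ.- (+ 4 ℤ.* (+ 4 ℤ.* a ℤ.* c ℤ.- b ℤ.* b) ℤ.- 1ℤ) ≡
                        + 2 ℤ.* b ℤ.* (+ 2 ℤ.* b) ℤ.+ 1ℤ ℤ.* 1ℤ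
      ident = ℤ-Ring.solve-∀
      p∣4b²+1 : + p ℤ∣.∣ + 2 ℤ.* b ℤ.* (+ 2 ℤ.* b) ℤ.+ 1ℤ ℤ.* 1ℤ
      p∣4b²+1 = subst (+ p ℤ∣.∣_) (trans (cong (λ e → + 16 ℤ.* c ℤ.* a ℤ.- e) e≡4d-1) (ident a b c))
        (ℤ∣.∣m∣n⇒∣m-n (ℤ∣.∣n⇒∣m*n (+ 16 ℤ.* c) (ℤ∣.∣ᵤ⇒∣ p∣a)) p∣e)

    p∤16a : p ∤ 16 * suc k
    p∤16a = ∤-* {m = 16} prime (∤-* {m = 4} prime (∤4 p3) (∤4 p3)) p∤a

    ident : ∀ a b c x y →
      + 16 ℤ.* a ℤ.* (a ℤ.* (x ℤ.* x) ℤ.+ b ℤ.* (x ℤ.* y) ℤ.+ c ℤ.* (y ℤ.* y)) ≡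
      (+ 4 ℤ.* (+ 4 ℤ.* a ℤ.* c ℤ.- b ℤ.* b) ℤ.- 1ℤ) ℤ.* (y ℤ.* y) ℤ.+
      ((+ 4 ℤ.* a ℤ.* x ℤ.+ + 2 ℤ.* b ℤ.* y) ℤ.* (+ 4 ℤ.* a ℤ.* x ℤ.+ + 2 ℤ.* b ℤ.* y) ℤ.+ y ℤ.* y)
    ident = ℤ-Ring.solve-∀

    ∣⇒²∣ : ∀ x y {t} → evalQuad (quadraticForm a b c) x y ≡ + t → p ∣ t → p * p ∣ t
    ∣⇒²∣ x y {t} eq p∣t = p²∣kt⇒p²∣t p3 p∤16a (subst (_ ℤ∣.∣_) (sym 16at≡)
      (ℤ∣.∣m∣n⇒∣m+n (ℤ∣.∣n⇒∣m*n e (*-pres-∣ℤ p∣y p∣y))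
                    (ℤ∣.∣m∣n⇒∣m+n (*-pres-∣ℤ p∣X p∣X) (*-pres-∣ℤ p∣y p∣y))))
      where
      X = + 4 ℤ.* a ℤ.* x ℤ.+ + 2 ℤ.* b ℤ.* y
      16at≡ : + (16 * suc k) ℤ.* + t ≡ e ℤ.* (y ℤ.* y) ℤ.+ (X ℤ.* X ℤ.+ y ℤ.* y)
      16at≡ = trans (cong₂ ℤ._*_ (ℤ.pos-* 16 (suc k)) (sym eq))
        (trans (ident a b c x y) (cong (λ e → e ℤ.* (y ℤ.* y) ℤ.+ (X ℤ.* X ℤ.+ y ℤ.* y)) (sym e≡4d-1)))
      p∣X²+y² : + p ℤ∣.∣ X ℤ.* X ℤ.+ y ℤ.* y
      p∣X²+y² = ℤ∣.∣m+n∣m⇒∣n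
        (subst (+ p ℤ∣.∣_) 16at≡ (ℤ∣.∣n⇒∣m*n (+ (16 * suc k)) (ℤ∣.∣ᵤ⇒∣ p∣t)))
        (ℤ∣.∣m⇒∣m*n (y ℤ.* y) p∣e)
      p∣y : + p ℤ∣.∣ y
      p∣y = ∣i²+j²⇒∣j p3 X y p∣X²+y²
      p∣X : + p ℤ∣.∣ X
      p∣X = ∣i²+j²⇒∣i p3 X y p∣X²+y²

PositiveSemidefinite : QuadraticForm → Set
PositiveSemidefinite F = ∀ x y → 0ℤ ℤ.≤ evalQuad F x y

obstructing-prime : ∀ F → PositiveSemidefinite F → ∃[ p ] p Obstructs F
obstructing-prime F@(quadraticForm a b c) F≥0 = byLeading a refl
  where
  a≥0 : 0ℤ ℤ.≤ a
  a≥0 = subst (0ℤ ℤ.≤_) (ident a b c) (F≥0 1ℤ 0ℤ)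
    where
    ident : ∀ a b c → a ℤ.* (1ℤ ℤ.* 1ℤ) ℤ.+ b ℤ.* (1ℤ ℤ.* 0ℤ) ℤ.+ c ℤ.* (0ℤ ℤ.* 0ℤ) ≡ a
    ident = ℤ-Ring.solve-∀

  c≥0 : 0ℤ ℤ.≤ c
  c≥0 = subst (0ℤ ℤ.≤_) (ident a b c) (F≥0 0ℤ 1ℤ)
    where
    ident : ∀ a b c → a ℤ.* (0ℤ ℤ.* 0ℤ) ℤ.+ b ℤ.* (0ℤ ℤ.* 1ℤ) ℤ.+ c ℤ.* (1ℤ ℤ.* 1ℤ) ≡ c
    ident = ℤ-Ring.solve-∀

  c≡+∣c∣ : c ≡ + ∣ c ∣
  c≡+∣c∣ = sym (ℤ.0≤i⇒+∣i∣≡i c≥0)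

  -- The point (-b, 2a) is a zero of 2ax + by, so only the discriminant term of 4aF survives there.
  ad≥0 : 0ℤ ℤ.≤ a ℤ.* negDisc F
  ad≥0 = subst (0ℤ ℤ.≤_) (ident a b c) (F≥0 (ℤ.- b) (+ 2 ℤ.* a))
    where
    ident : ∀ a b c →
      a ℤ.* (ℤ.- b ℤ.* ℤ.- b) ℤ.+ b ℤ.* (ℤ.- b ℤ.* (+ 2 ℤ.* a)) ℤ.+ c ℤ.* (+ 2 ℤ.* a ℤ.* (+ 2 ℤ.* a)) ≡
      a ℤ.* (+ 4 ℤ.* a ℤ.* c ℤ.- b ℤ.* b)
    ident = ℤ-Ring.solve-∀

  -- For a = 0 and b ≠ 0 the value F(-b(c+1), 1) = c - b²(c+1) is negative.
  a≡0⇒b≡0 : a ≡ 0ℤ → b ≡ 0ℤ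
  a≡0⇒b≡0 a≡0 = byAbs ∣ b ∣ refl
    where
    ident : ∀ b c →
      0ℤ ℤ.* (ℤ.- b ℤ.* (c ℤ.+ 1ℤ) ℤ.* (ℤ.- b ℤ.* (c ℤ.+ 1ℤ))) ℤ.+
      b ℤ.* (ℤ.- b ℤ.* (c ℤ.+ 1ℤ) ℤ.* 1ℤ) ℤ.+ c ℤ.* (1ℤ ℤ.* 1ℤ) ≡
      -1ℤ ℤ.- (b ℤ.* b ℤ.- 1ℤ) ℤ.* (c ℤ.+ 1ℤ)
    ident = ℤ-Ring.solve-∀
    byAbs : ∀ m → ∣ b ∣ ≡ m → b ≡ 0ℤ
    byAbs zero    ∣b∣≡0 = ℤ.∣i∣≡0⇒i≡0 ∣b∣≡0
    byAbs (suc m) ∣b∣≡ = contradiction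
      (subst (0ℤ ℤ.≤_) value (F≥0 (ℤ.- b ℤ.* (c ℤ.+ 1ℤ)) 1ℤ)) neg
      where
      -- The negative value is written as -1 - r with r = (b² - 1)(c + 1) a natural number; for |b|
      -- = m + 1, b² - 1 = m + m(m + 1).
      r = (m + m * suc m) * (∣ c ∣ + 1)
      b²-1 : b ℤ.* b ℤ.- 1ℤ ≡ + (m + m * suc m)
      b²-1 = cong (ℤ._- 1ℤ) (trans (i*i≡+∣i∣*∣i∣ b) (cong (λ s → + (s * s)) ∣b∣≡))
      value : evalQuad F (ℤ.- b ℤ.* (c ℤ.+ 1ℤ)) 1ℤ ≡ -1ℤ ℤ.- + r
      value = trans (cong (λ a → evalQuad (quadraticForm a b c) (ℤ.- b ℤ.* (c ℤ.+ 1ℤ)) 1ℤ) a≡0)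
        (trans (ident b c) (cong (λ s → -1ℤ ℤ.- s)
          (trans (cong₂ ℤ._*_ b²-1 (cong (ℤ._+ 1ℤ) c≡+∣c∣)) (sym (ℤ.pos-* (m + m * suc m) (∣ c ∣ + 1))))))
      neg : ¬ 0ℤ ℤ.≤ -1ℤ ℤ.- + r
      neg 0≤ with r
      ... | zero  = contradiction 0≤ λ ()
      ... | suc _ = contradiction 0≤ λ ()

  byLeading : ∀ a′ → a ≡ a′ → ∃[ p ] p Obstructs F
  byLeading -[1+ _ ] refl = contradiction a≥0 λ ()
  byLeading (+ zero) a≡0 = subst (λ F → ∃[ p ] p Obstructs F)
    (sym (trans (cong₂ (λ a b → quadraticForm a b c) a≡0 (a≡0⇒b≡0 a≡0)) (cong (quadraticForm 0ℤ 0ℤ) c≡+∣c∣)))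
    (obstruction-a≡0∧b≡0 ∣ c ∣)
  byLeading (+ suc k) refl = byDisc (negDisc F) refl
    where
    byDisc : ∀ d → negDisc F ≡ d → ∃[ p ] p Obstructs F
    byDisc (+ zero)  d≡ = obstruction-parabolic k b c d≡
    byDisc (+ suc d) d≡ = obstruction-definite k b c d d≡
    -- Here a > 0, so `ad≥0` rules out a negative d.
    byDisc -[1+ _ ]  d≡ = contradiction (subst (λ d → 0ℤ ℤ.≤ a ℤ.* d) d≡ ad≥0) λ ()

-- F is the squared norm of the first vector, a sum of three squares.
F-positiveSemidefinite : ∀ P → PositiveSemidefinite (Parameterization.F P)
F-positiveSemidefinite P x y = subst (0ℤ ℤ.≤_) (equal-norm x y zero)
  (ℤ.+-mono-≤ (0≤i*i (v zero)) (ℤ.+-mono-≤ (0≤i*i (v (suc zero))) (ℤ.+-mono-≤ (0≤i*i (v (suc (suc zero)))) ℤ.≤-refl)))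
  where
  open Parameterization P
  v = at x y zero

-- Squarefree products

squareFree-prime : ∀ {p} → Prime p → SquareFree p
squareFree-prime {p} pr d d²∣p with prime⇒irreducible pr (m*n∣⇒m∣ d d d²∣p)
... | inj₁ d≡1  = d≡1
... | inj₂ refl = ∣1⇒≡1 (*-cancelˡ-∣ p {{prime⇒nonZero pr}} (subst (p * p ∣_) (sym (*-identityʳ p)) d²∣p))

-- If p ∣ d, then p² ∣ ps and so p ∣ s, which is excluded. Otherwise d² is coprime to p and already
-- divides s.
squareFree-* : ∀ {p s} → Prime p → p ∤ s → SquareFree s → SquareFree (p * s)
squareFree-* {p} {s} pr p∤s sf d d²∣ps with p ∣? d
... | yes p∣d = contradiction (*-cancelˡ-∣ p {{prime⇒nonZero pr}} (∣-trans (*-pres-∣ p∣d p∣d) d²∣ps)) p∤s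
... | no p∤d  = sf d (coprime-divisor (λ (e∣d² , e∣p) → prime∤⇒coprime pr p∤d² (e∣p , e∣d²)) d²∣ps)
  where
  p∤d² : p ∤ d * d
  p∤d² = ∤-* pr p∤d p∤d

squareFree⇒p²∤ : ∀ {p s} → Prime p → SquareFree s → p * p ∤ s
squareFree⇒p²∤ {p} pr sf p²∣s = ¬prime[1] (subst Prime (sf p p²∣s) pr)

-- Construction of t

-- Oddness makes 2s squarefree and ≡ 2 (mod 4). The factor 5 is an odd prime ≡ 2 (mod 3), as
-- membership in `T` demands.
record ObstructingMultiple (𝒫 : List Parameterization) : Set where
  field
    s          : ℕ
    odd        : s % 2 ≡ 1
    squareFree : SquareFree s
    5∣s        : 5 ∣ s
    obstructed   : All (λ P → ∃[ p ] p Obstructs Parameterization.F P × p ∣ s) 𝒫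

obstructingMultiple : ∀ 𝒫 → ObstructingMultiple 𝒫
obstructingMultiple [] = record
  { s          = 5
  ; odd        = refl
  ; squareFree = squareFree-prime (toWitness {a? = prime? 5} _)
  ; 5∣s        = ∣-refl
  ; obstructed   = []
  }
obstructingMultiple (P ∷ 𝒫)
  with record { s = s ; odd = odd ; squareFree = sf ; 5∣s = 5∣s ; obstructed = ram } ← obstructingMultiple 𝒫
     | p , pR ← obstructing-prime (Parameterization.F P) (F-positiveSemidefinite P)
  with p ∣? s
-- A prime obtained earlier must not be multiplied in again, or s would cease to be squarefree.
... | yes p∣s = record
  { s = s ; odd = odd ; squareFree = sf ; 5∣s = 5∣s ; obstructed = (p , pR , p∣s) ∷ ram }
... | no p∤s = record
  { s          = p * s
  ; odd        = trans (%-distribˡ-* p s 2) (cong₂ (λ i j → i * j % 2) (%4≡3⇒%2≡1 p %4≡3) odd)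
  ; squareFree = squareFree-* prime p∤s sf
  ; 5∣s        = ∣n⇒∣m*n p 5∣s
  ; obstructed   = (p , pR , m∣m*n s) ∷ All.map (λ (q , qR , q∣s) → q , qR , ∣n⇒∣m*n p q∣s) ram
  }
  where open Prime3mod4 (_Obstructs_.prime3mod4 pR)

theorem8 : (𝒫 : List Parameterization) → ∃[ t ] (T t × All (λ P → ¬ (P Represents t)) 𝒫)
theorem8 𝒫 = t , t∈T , All.map (λ {P} → unrepresented P) obstructed
  where
  open ObstructingMultiple (obstructingMultiple 𝒫)

  t = 2 * s

  t-squareFree : SquareFree t
  t-squareFree = squareFree-* prime[2]
    (λ 2∣s → contradiction (trans (sym odd) (n∣m⇒m%n≡0 s 2 2∣s)) λ ()) squareFree

  t%4≡2 : t % 4 ≡ 2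
  t%4≡2 = trans (cong (λ n → 2 * n % 4) (trans (m≡m%n+[m/n]*n s 2) (cong (_+ s / 2 * 2) odd)))
    (trans (cong (_% 4) (ident (s / 2))) ([m+kn]%n≡m%n 2 (s / 2) 4))
    where
    ident : ∀ h → 2 * (1 + h * 2) ≡ 2 + h * 4
    ident = ℕ-Ring.solve-∀

  t∈T : T t
  t∈T = record
    { positive    = n≢0⇒n>0 (λ t≡0 → contradiction (trans (sym (cong (_% 4) t≡0)) t%4≡2) λ ())
    ; 2-mod-4     = t%4≡2
    ; s           = t
    -- Being squarefree, t is its own square-free part, with square cofactor 1².
    ; s-sqfPart   = t-squareFree , 1 , sym (*-identityʳ t)
    ; p           = 5
    ; p-prime     = toWitness {a? = prime? 5} _
    ; p-odd       = refl
    ; p-divides-s = ∣n⇒∣m*n 2 5∣s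
    ; p-2-mod-3   = refl
    }

  unrepresented : ∀ P → ∃[ p ] p Obstructs Parameterization.F P × p ∣ s → ¬ (P Represents t)
  -- A representation would give p² ∣ t from p ∣ t, against squarefreeness.
  unrepresented _ (p , pR , p∣s) (x , y , eq) =
    squareFree⇒p²∤ (Prime3mod4.prime (_Obstructs_.prime3mod4 pR)) t-squareFree
      (_Obstructs_.∣⇒²∣ pR x y eq (∣n⇒∣m*n 2 p∣s))
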